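{- Let $\psi_0\mathrel{\mathcal R}\psi_1\mathrel{\mathcal R}\cdots\mathrel{\mathcal R}\psi_q$ be any finite chain of admissible revisions, with $\psi_0,\dots,\psi_q\in\Psi$, and write the protected components of $\psi_0$ as $\varphi_1^{\mathrm{core}}$ and $\varphi_2^{\mathrm{core}}$. Then, for every $i\in\{0,\ldots,q\}$: (1) the protected components of $\psi_i$ are exactly $\varphi_1^{\mathrm{core}}$ and $\varphi_2^{\mathrm{core}}$; (2) for every timed stream $\mathbf e$ and event index $n$, $\mathbf e,n\models\varphi_1^{\mathrm{core}}$ implies $\mathbf e,n\models\operatorname{trig}(\psi_i)$; (3) for every timed stream $\mathbf e$ and event index $m$, $\mathbf e,m\models\operatorname{resp}(\psi_i)$ implies $\mathbf e,m\models\varphi_2^{\mathrm{core}}$; (4) the parameter tuple of $\psi_i$ belongs to $\mathcal A_{\mathrm{par}}$.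
   Context: Timed streams. Let $\mathcal{AP}$ be a finite set of atomic propositions. An infinite timed stream is a sequence $\mathbf e=e_0e_1e_2\cdots$ with $e_n=(t_n,\nu_n)$, $t_n\in\mathbb R_{\ge0}$, $\nu_n\subseteq\mathcal{AP}$, $t_n\le t_{n+1}$ for all $n$, and $\lim_{n\to\infty}t_n=\infty$ (non-Zeno). The satisfaction relation below is defined over infinite timed streams. Formulas. $\Phi$ is the set of formulas generated by $\varphi::=p\mid\top\mid\bot\mid\neg\varphi\mid\varphi\land\varphi\mid\varphi\lor\varphi\mid\Box_{[a,b]}\varphi\mid\Diamond_{[a,b]}\varphi$ with $p\in\mathcal{AP}$, $0\le a\le b<\infty$. Satisfaction $\mathbf e,n\models\varphi$: $\mathbf e,n\models p$ iff $p\in\nu_n$; $\top$ always holds, $\bot$ never; Boolean connectives as usual; $\mathbf e,n\models\Box_{[a,b]}\varphi$ iff for all $m\ge n$ with $t_m-t_n\in[a,b]$, $\mathbf e,m\models\varphi$; $\mathbf e,n\models\Diamond_{[a,b]}\varphi$ iff there is $m\ge n$ with $t_m-t_n\in[a,b]$ and $\mathbf e,m\models\varphi$. Specifications. A parameter envelope $\mathcal A_{\mathrm{par}}\subseteq\{(\lambda,a,b)\in[0,1]\times\mathbb R_{\ge0}^2: 0\le a\le b<\infty\}$ is fixed. A (probabilistic trigger--response) specification is a tuple $\psi=(\varphi_1^{\mathrm{core}},\varphi_1^{\mathrm{adapt}},\varphi_2^{\mathrm{core}},\varphi_2^{\mathrm{adapt}},\lambda,a,b)$ with the four formulas in $\Phi$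 and $(\lambda,a,b)\in\mathcal A_{\mathrm{par}}$; $\Psi$ is the set of such tuples. $\varphi_1^{\mathrm{core}},\varphi_2^{\mathrm{core}}$ are the protected components, $\varphi_1^{\mathrm{adapt}},\varphi_2^{\mathrm{adapt}}$ the adaptive components, and $(\lambda,a,b)$ the parameter tuple. The derived trigger and response are $\operatorname{trig}(\psi)=\varphi_1^{\mathrm{core}}\lor\varphi_1^{\mathrm{adapt}}$ and $\operatorname{resp}(\psi)=\varphi_2^{\mathrm{core}}\land\varphi_2^{\mathrm{adapt}}$. Equality in $\Psi$ is componentwise tuple equality. Admissible revision. $\mathcal R\subseteq\Psi\times\Psi$ is a relation such that whenever $\psi\mathrel{\mathcal R}\widetilde\psi$: (i) the protected components of $\psi$ and $\widetilde\psi$ are the same; (ii) at most one of the two adaptive components of $\widetilde\psi$ differs from its counterpart in $\psi$; (iii) the parameter tuple of $\widetilde\psi$ belongs to $\mathcal A_{\mathrm{par}}$; (iv) at least one adaptive component or the parameter tuple of $\widetilde\psi$ differs from its counterpart in $\psi$. -}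

module Defs where

open import Level using (Level; _⊔_; 0ℓ) renaming (suc to lsuc)
open import Data.Nat.Base as ℕ using (ℕ)
import Data.Nat.Properties as ℕ
open import Data.Rational.Base as ℚ using (ℚ; 0ℚ; 1ℚ; ½)
import Data.Rational.Properties as ℚ
open import Data.Rational.Solver using (module +-*-Solver)
open import Data.Product.Base using (_×_; _,_; ∃-syntax)
open import Data.Sum.Base using (_⊎_)
open import Data.Unit.Base using (⊤)
open import Data.Empty using (⊥)
open import Data.Fin.Base using (Fin)
open import Function.Bundles using (_↔_)
open import Relation.Nullary.Negation using (¬_)
open import Relation.Unary using (Pred; _∈_)
open import Relation.Binary.Core using (Rel)
open import Relation.Binary.Definitions using (_Respects_; _Respects₂_)
open import Relation.Binary.PropositionalEquality using (_≡_; refl; sym; cong; subst)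

-- Real numbers: Cauchy sequences of rationals.  As quotients are not
-- available, equality of reals is the relation _≈_ (the difference tends
-- to 0), and every equality between objects containing reals is taken up
-- to it.

record ℝ : Set where
  field
    seq    : ℕ → ℚ
    cauchy : ∀ ε → 0ℚ ℚ.< ε →
             ∃[ N ] ∀ m n → N ℕ.≤ m → N ℕ.≤ n → ℚ.∣ seq m ℚ.- seq n ∣ ℚ.≤ ε

open ℝ public

infix 4 _≈_ _≤_

_≈_ : ℝ → ℝ → Set
x ≈ y = ∀ ε → 0ℚ ℚ.< ε →
        ∃[ N ] ∀ n → N ℕ.≤ n → ℚ.∣ seq x n ℚ.- seq y n ∣ ℚ.≤ ε

_≤_ : ℝ → ℝ → Set
x ≤ y = ∀ ε → 0ℚ ℚ.< ε →
        ∃[ N ] ∀ n → N ℕ.≤ n → seq x n ℚ.≤ seq y n ℚ.+ ε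

fromℚ : ℚ → ℝ
fromℚ q = record
  { seq    = λ _ → q
  ; cauchy = λ ε 0<ε → 0 , λ _ _ _ _ →
      subst (λ r → ℚ.∣ r ∣ ℚ.≤ ε) (sym (ℚ.+-inverseʳ q)) (ℚ.<⇒≤ 0<ε)
  }

0ℝ 1ℝ : ℝ
0ℝ = fromℚ 0ℚ
1ℝ = fromℚ 1ℚ

private
  ½+½ : ∀ ε → ½ ℚ.* ε ℚ.+ ½ ℚ.* ε ≡ ε
  ½+½ = solve 1 (λ e → con ½ :* e :+ con ½ :* e := e) refl
    where open +-*-Solver

  0<½* : ∀ ε → 0ℚ ℚ.< ε → 0ℚ ℚ.< ½ ℚ.* ε
  0<½* ε 0<ε = subst (ℚ._< ½ ℚ.* ε) (ℚ.*-zeroʳ ½) (ℚ.*-monoʳ-<-pos ½ 0<ε)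

  rearrange : ∀ a b c d →
              (a ℚ.- b) ℚ.- (c ℚ.- d) ≡ (a ℚ.- c) ℚ.- (b ℚ.- d)
  rearrange = solve 4 (λ a b c d →
                (a :- b) :- (c :- d) := (a :- c) :- (b :- d)) refl
    where open +-*-Solver

infixl 6 _-_

_-_ : ℝ → ℝ → ℝ
seq    (x - y) n = seq x n ℚ.- seq y n
cauchy (x - y) ε 0<ε with cauchy x (½ ℚ.* ε) (0<½* ε 0<ε)
                        | cauchy y (½ ℚ.* ε) (0<½* ε 0<ε)
... | N , p | M , q = N ℕ.⊔ M , λ m n N⊔M≤m N⊔M≤n → begin
  ℚ.∣ (seq x m ℚ.- seq y m) ℚ.- (seq x n ℚ.- seq y n) ∣
    ≡⟨ cong ℚ.∣_∣ (rearrange (seq x m) (seq y m) (seq x n) (seq y n)) ⟩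
  ℚ.∣ (seq x m ℚ.- seq x n) ℚ.- (seq y m ℚ.- seq y n) ∣
    ≤⟨ ℚ.∣p-q∣≤∣p∣+∣q∣ (seq x m ℚ.- seq x n) (seq y m ℚ.- seq y n) ⟩
  ℚ.∣ seq x m ℚ.- seq x n ∣ ℚ.+ ℚ.∣ seq y m ℚ.- seq y n ∣
    ≤⟨ ℚ.+-mono-≤
         (p m n (ℕ.m⊔n≤o⇒m≤o N M N⊔M≤m) (ℕ.m⊔n≤o⇒m≤o N M N⊔M≤n))
         (q m n (ℕ.m⊔n≤o⇒n≤o N M N⊔M≤m) (ℕ.m⊔n≤o⇒n≤o N M N⊔M≤n)) ⟩
  ½ ℚ.* ε ℚ.+ ½ ℚ.* ε
    ≡⟨ ½+½ ε ⟩
  ε ∎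
  where open ℚ.≤-Reasoning

Finite : Set → Set
Finite A = ∃[ k ] (A ↔ Fin k)

record TimedStream (AP : Set) : Set₁ where
  field
    time     : ℕ → ℝ
    val      : ℕ → Pred AP 0ℓ
    time≥0   : ∀ n → 0ℝ ≤ time n
    monotone : ∀ n → time n ≤ time (ℕ.suc n)
    nonZeno  : ∀ B → ∃[ N ] ∀ n → N ℕ.≤ n → B ≤ time n

record Interval : Set where
  field
    lo hi : ℝ
    0≤lo  : 0ℝ ≤ lo
    lo≤hi : lo ≤ hi

infix 4 _∈ᴵ_ _≈ᴵ_

_∈ᴵ_ : ℝ → Interval → Set
x ∈ᴵ I = Interval.lo I ≤ x × x ≤ Interval.hi I

_≈ᴵ_ : Rel Interval 0ℓ
I ≈ᴵ J = Interval.lo I ≈ Interval.lo J × Interval.hi I ≈ Interval.hi J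

infix  9 ¬ᶠ_ □[_]_ ◇[_]_
infixr 7 _∧ᶠ_
infixr 6 _∨ᶠ_

data Formula (AP : Set) : Set where
  atom      : AP → Formula AP
  ⊤ᶠ ⊥ᶠ     : Formula AP
  ¬ᶠ_       : Formula AP → Formula AP
  _∧ᶠ_ _∨ᶠ_ : Formula AP → Formula AP → Formula AP
  □[_]_     : Interval → Formula AP → Formula AP
  ◇[_]_     : Interval → Formula AP → Formula AP

-- Syntactic equality of formulas.  Propositional equality would
-- distinguish different Cauchy sequences for the same interval endpoint.

infix 4 _≈ᶠ_

data _≈ᶠ_ {AP : Set} : Rel (Formula AP) 0ℓ where
  atom  : ∀ {p q} → p ≡ q → atom p ≈ᶠ atom q
  ⊤ᶠ    : ⊤ᶠ ≈ᶠ ⊤ᶠ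
  ⊥ᶠ    : ⊥ᶠ ≈ᶠ ⊥ᶠ
  ¬ᶠ_   : ∀ {φ φ′} → φ ≈ᶠ φ′ → ¬ᶠ φ ≈ᶠ ¬ᶠ φ′
  _∧ᶠ_  : ∀ {φ φ′ χ χ′} → φ ≈ᶠ φ′ → χ ≈ᶠ χ′ → φ ∧ᶠ χ ≈ᶠ φ′ ∧ᶠ χ′
  _∨ᶠ_  : ∀ {φ φ′ χ χ′} → φ ≈ᶠ φ′ → χ ≈ᶠ χ′ → φ ∨ᶠ χ ≈ᶠ φ′ ∨ᶠ χ′
  □[_]_ : ∀ {I J φ φ′} → I ≈ᴵ J → φ ≈ᶠ φ′ → □[ I ] φ ≈ᶠ □[ J ] φ′
  ◇[_]_ : ∀ {I J φ φ′} → I ≈ᴵ J → φ ≈ᶠ φ′ → ◇[ I ] φ ≈ᶠ ◇[ J ] φ′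

infix 4 _at_⊨_

_at_⊨_ : {AP : Set} → TimedStream AP → ℕ → Formula AP → Set
e at n ⊨ atom p   = p ∈ TimedStream.val e n
e at n ⊨ ⊤ᶠ       = ⊤
e at n ⊨ ⊥ᶠ       = ⊥
e at n ⊨ ¬ᶠ φ     = ¬ (e at n ⊨ φ)
e at n ⊨ φ ∧ᶠ χ   = (e at n ⊨ φ) × (e at n ⊨ χ)
e at n ⊨ φ ∨ᶠ χ   = (e at n ⊨ φ) ⊎ (e at n ⊨ χ)
e at n ⊨ □[ I ] φ = ∀ m → n ℕ.≤ m → time m - time n ∈ᴵ I → e at m ⊨ φ
  where open TimedStream e
e at n ⊨ ◇[ I ] φ = ∃[ m ] n ℕ.≤ m × time m - time n ∈ᴵ I × e at m ⊨ φ
  where open TimedStream e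

-- The parameter tuple (λ, a, b).
record Params : Set where
  constructor ⟨_,_,_⟩
  field
    prob lower upper : ℝ

infix 4 _≈ᵖ_

_≈ᵖ_ : Rel Params 0ℓ
⟨ l , a , b ⟩ ≈ᵖ ⟨ l′ , a′ , b′ ⟩ = l ≈ l′ × a ≈ a′ × b ≈ b′

record ParameterEnvelope (ℓ : Level) : Set (lsuc ℓ) where
  field
    Member   : Pred Params ℓ
    respects : Member Respects _≈ᵖ_
    bounds   : ∀ {l a b} → Member ⟨ l , a , b ⟩ →
               (0ℝ ≤ l × l ≤ 1ℝ) × 0ℝ ≤ a × a ≤ b

open ParameterEnvelope public using (Member)

record Spec (AP : Set) {ℓ : Level} (𝒜 : ParameterEnvelope ℓ) : Set ℓ where
  field
    core₁ adapt₁ core₂ adapt₂ : Formula AP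
    params                    : Params
    params∈𝒜                  : params ∈ Member 𝒜

open Spec public

module _ {AP : Set} {ℓ : Level} {𝒜 : ParameterEnvelope ℓ} where

  trig resp : Spec AP 𝒜 → Formula AP
  trig ψ = core₁ ψ ∨ᶠ adapt₁ ψ
  resp ψ = core₂ ψ ∧ᶠ adapt₂ ψ

  infix 4 _≈ˢ_

  _≈ˢ_ : Rel (Spec AP 𝒜) 0ℓ
  ψ ≈ˢ χ = core₁ ψ ≈ᶠ core₁ χ × adapt₁ ψ ≈ᶠ adapt₁ χ
         × core₂ ψ ≈ᶠ core₂ χ × adapt₂ ψ ≈ᶠ adapt₂ χ
         × params ψ ≈ᵖ params χ

  record IsAdmissibleRevision {r : Level} (R : Rel (Spec AP 𝒜) r) : Set (ℓ ⊔ r) where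
    field
      respects   : R Respects₂ _≈ˢ_
      sameCores  : ∀ {ψ ψ̃} → R ψ ψ̃ →
                   core₁ ψ̃ ≈ᶠ core₁ ψ × core₂ ψ̃ ≈ᶠ core₂ ψ
      atMostOne  : ∀ {ψ ψ̃} → R ψ ψ̃ →
                   ¬ (¬ (adapt₁ ψ̃ ≈ᶠ adapt₁ ψ) × ¬ (adapt₂ ψ̃ ≈ᶠ adapt₂ ψ))
      inEnvelope : ∀ {ψ ψ̃} → R ψ ψ̃ → params ψ̃ ∈ Member 𝒜
      nontrivial : ∀ {ψ ψ̃} → R ψ ψ̃ →
                   ¬ (adapt₁ ψ̃ ≈ᶠ adapt₁ ψ) ⊎ ¬ (adapt₂ ψ̃ ≈ᶠ adapt₂ ψ)
                   ⊎ ¬ (params ψ̃ ≈ᵖ params ψ)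

{-# OPTIONS --safe #-}
module Submission where

open import Defs
open import Level using (Level)
open import Data.Nat.Base as ℕ using (ℕ; suc)
import Data.Nat.Properties as ℕ
open import Data.Fin.Base using (Fin; zero; suc; inject₁)
open import Data.Fin.Induction using (<-weakInduction)
open import Data.Product.Base using (_×_; _,_; proj₁; proj₂; map; map₂)
open import Data.Product.Function.NonDependent.Propositional using (_×-⇔_)
open import Data.Rational.Base as ℚ using (0ℚ; ½)
import Data.Rational.Properties as ℚ
open import Data.Rational.Solver using (module +-*-Solver)
open import Data.Sum.Base using (inj₁; inj₂)
open import Data.Sum.Function.Propositional using (_⊎-⇔_)
open import Function.Base using (_∘_)
open import Function.Bundles using (_⇔_; mk⇔; Equivalence)
open import Function.Construct.Identity using (⇔-id)
open import Function.Related.TypeIsomorphisms using (¬-cong-⇔)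
open import Relation.Binary.Core using (Rel)
open import Relation.Binary.Definitions using (Reflexive; Symmetric; Transitive; _Respects_)
open import Relation.Binary.PropositionalEquality using (_≡_; refl; sym; trans; cong; subst)
open import Relation.Unary using (_∈_)

-- By induction along the chain every ψᵢ has the cores of ψ₀ up to ≈ᶠ.  Hence
-- core₁ ψ₀ yields the left disjunct of trig ψᵢ, and the left conjunct of
-- resp ψᵢ yields core₂ ψ₀, because satisfaction is invariant under ≈ᶠ.

p≤∣p∣ : ∀ p → p ℚ.≤ ℚ.∣ p ∣
p≤∣p∣ p with ℚ.≤-total 0ℚ p
... | inj₁ 0≤p = ℚ.≤-reflexive (sym (ℚ.0≤p⇒∣p∣≡p 0≤p))
... | inj₂ p≤0 = ℚ.≤-trans p≤0 (ℚ.0≤∣p∣ p)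

-[p-q]≡q-p : ∀ p q → ℚ.- (p ℚ.- q) ≡ q ℚ.- p
-[p-q]≡q-p = solve 2 (λ p q → :- (p :- q) := q :- p) refl
  where
  open +-*-Solver

∣p-q∣≡∣q-p∣ : ∀ p q → ℚ.∣ p ℚ.- q ∣ ≡ ℚ.∣ q ℚ.- p ∣
∣p-q∣≡∣q-p∣ p q = trans (sym (ℚ.∣-p∣≡∣p∣ (p ℚ.- q))) (cong ℚ.∣_∣ (-[p-q]≡q-p p q))

-- `_≤_` on reals puts the slack on the right-hand side, whereas `_≈_` bounds a difference. This
-- lemma and the next pass between the two shapes.
p-q≤r⇒p≤q+r : ∀ p q {r} → p ℚ.- q ℚ.≤ r → p ℚ.≤ q ℚ.+ r
p-q≤r⇒p≤q+r p q {r} p-q≤r = begin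
  p                ≡⟨ solve 2 (λ p q → p := q :+ (p :- q)) refl p q ⟩
  q ℚ.+ (p ℚ.- q)  ≤⟨ ℚ.+-monoʳ-≤ q p-q≤r ⟩
  q ℚ.+ r          ∎
  where
  open ℚ.≤-Reasoning
  open +-*-Solver

p≤q+r⇒p-q≤r : ∀ p q {r} → p ℚ.≤ q ℚ.+ r → p ℚ.- q ℚ.≤ r
p≤q+r⇒p-q≤r p q {r} p≤q+r = begin
  p ℚ.- q          ≤⟨ ℚ.+-monoˡ-≤ (ℚ.- q) p≤q+r ⟩
  q ℚ.+ r ℚ.- q    ≡⟨ solve 2 (λ q r → q :+ r :- q := r) refl q r ⟩
  r                ∎
  where
  open ℚ.≤-Reasoning
  open +-*-Solver

∣p-q∣≤r : ∀ p q {r} → p ℚ.≤ q ℚ.+ r → q ℚ.≤ p ℚ.+ r → ℚ.∣ p ℚ.- q ∣ ℚ.≤ r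
∣p-q∣≤r p q {r} p≤q+r q≤p+r with ℚ.∣p∣≡p∨∣p∣≡-p (p ℚ.- q)
... | inj₁ eq = subst (ℚ._≤ r) (sym eq) (p≤q+r⇒p-q≤r p q p≤q+r)
... | inj₂ eq = subst (ℚ._≤ r) (sym (trans eq (-[p-q]≡q-p p q))) (p≤q+r⇒p-q≤r q p q≤p+r)

0<p⇒0<½*p : ∀ {p} → 0ℚ ℚ.< p → 0ℚ ℚ.< ½ ℚ.* p
0<p⇒0<½*p {p} 0<p = subst (ℚ._< ½ ℚ.* p) (ℚ.*-zeroʳ ½) (ℚ.*-monoʳ-<-pos ½ 0<p)

-- Each hypothesis is used with half the tolerance, and both bounds hold from the larger of the two
-- thresholds on.
≤-trans : Transitive _≤_
≤-trans {x} {y} {z} x≤y y≤z ε 0<ε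
  with N , p ← x≤y (½ ℚ.* ε) (0<p⇒0<½*p 0<ε) | M , q ← y≤z (½ ℚ.* ε) (0<p⇒0<½*p 0<ε) =
  N ℕ.⊔ M , λ n N⊔M≤n → begin
    seq x n
      ≤⟨ p n (ℕ.m⊔n≤o⇒m≤o N M N⊔M≤n) ⟩
    seq y n ℚ.+ ½ ℚ.* ε
      ≤⟨ ℚ.+-monoˡ-≤ (½ ℚ.* ε) (q n (ℕ.m⊔n≤o⇒n≤o N M N⊔M≤n)) ⟩
    seq z n ℚ.+ ½ ℚ.* ε ℚ.+ ½ ℚ.* ε
      ≡⟨ solve 2 (λ z e → z :+ con ½ :* e :+ con ½ :* e := z :+ e) refl (seq z n) ε ⟩
    seq z n ℚ.+ ε ∎
  where
  open ℚ.≤-Reasoning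
  open +-*-Solver

-- No halving here: the two one-sided bounds with the same `ε` together bound the absolute value.
≤-antisym : ∀ {x y} → x ≤ y → y ≤ x → x ≈ y
≤-antisym {x} {y} x≤y y≤x ε 0<ε with N , p ← x≤y ε 0<ε | M , q ← y≤x ε 0<ε =
  N ℕ.⊔ M , λ n N⊔M≤n → ∣p-q∣≤r (seq x n) (seq y n)
    (p n (ℕ.m⊔n≤o⇒m≤o N M N⊔M≤n))
    (q n (ℕ.m⊔n≤o⇒n≤o N M N⊔M≤n))

≈⇒≤ : ∀ {x y} → x ≈ y → x ≤ y
≈⇒≤ {x} {y} x≈y ε 0<ε = map₂ (λ p n N≤n →
  p-q≤r⇒p≤q+r (seq x n) (seq y n)
    (ℚ.≤-trans (p≤∣p∣ (seq x n ℚ.- seq y n)) (p n N≤n))) (x≈y ε 0<ε)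

≈-refl : Reflexive _≈_
≈-refl {x} ε 0<ε = 0 , λ n _ →
  subst (λ r → ℚ.∣ r ∣ ℚ.≤ ε) (sym (ℚ.+-inverseʳ (seq x n))) (ℚ.<⇒≤ 0<ε)

≈-sym : Symmetric _≈_
≈-sym {x} {y} x≈y ε 0<ε = map₂ (λ p n N≤n →
  subst (ℚ._≤ ε) (∣p-q∣≡∣q-p∣ (seq x n) (seq y n)) (p n N≤n)) (x≈y ε 0<ε)

-- Going through `_≤_` reuses the `ε`-splitting of `≤-trans`. The reals are passed explicitly
-- because both relations unfold to statements about `seq`, which do not determine the `cauchy`
-- component.
≈-trans : Transitive _≈_
≈-trans {x} {y} {z} x≈y y≈z = ≤-antisym {x} {z}
  (≤-trans {x} {y} {z} (≈⇒≤ {x} {y} x≈y) (≈⇒≤ {y} {z} y≈z))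
  (≤-trans {z} {y} {x} (≈⇒≤ {z} {y} (≈-sym {y} {z} y≈z)) (≈⇒≤ {y} {x} (≈-sym {x} {y} x≈y)))

≈ᴵ-refl : Reflexive _≈ᴵ_
≈ᴵ-refl {I} = ≈-refl {Interval.lo I} , ≈-refl {Interval.hi I}

≈ᴵ-sym : Symmetric _≈ᴵ_
≈ᴵ-sym {I} {J} = map (≈-sym {I.lo} {J.lo}) (≈-sym {I.hi} {J.hi})
  where
  module I = Interval I
  module J = Interval J

≈ᴵ-trans : Transitive _≈ᴵ_
≈ᴵ-trans {I} {J} {K} (lo , hi) (lo′ , hi′) =
  ≈-trans {I.lo} {J.lo} {K.lo} lo lo′ , ≈-trans {I.hi} {J.hi} {K.hi} hi hi′
  where
  module I = Interval I
  module J = Interval J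
  module K = Interval K

-- Makes the guards of the temporal operators independent of the Cauchy sequences chosen for the
-- endpoints.
∈ᴵ-respects : ∀ x → (x ∈ᴵ_) Respects _≈ᴵ_
∈ᴵ-respects x {I} {J} (lo≈ , hi≈) (lo≤x , x≤hi) =
  ≤-trans {J.lo} {I.lo} {x} (≈⇒≤ {J.lo} {I.lo} (≈-sym {I.lo} {J.lo} lo≈)) lo≤x ,
  ≤-trans {x} {I.hi} {J.hi} x≤hi (≈⇒≤ {I.hi} {J.hi} hi≈)
  where
  module I = Interval I
  module J = Interval J

module _ {AP : Set} where

  ≈ᶠ-refl : Reflexive (_≈ᶠ_ {AP})
  ≈ᶠ-refl {atom p}   = atom refl
  ≈ᶠ-refl {⊤ᶠ}       = ⊤ᶠ
  ≈ᶠ-refl {⊥ᶠ}       = ⊥ᶠ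
  ≈ᶠ-refl {¬ᶠ φ}     = ¬ᶠ ≈ᶠ-refl
  ≈ᶠ-refl {φ ∧ᶠ χ}   = ≈ᶠ-refl ∧ᶠ ≈ᶠ-refl
  ≈ᶠ-refl {φ ∨ᶠ χ}   = ≈ᶠ-refl ∨ᶠ ≈ᶠ-refl
  ≈ᶠ-refl {□[ I ] φ} = □[ ≈ᴵ-refl {I} ] ≈ᶠ-refl
  ≈ᶠ-refl {◇[ I ] φ} = ◇[ ≈ᴵ-refl {I} ] ≈ᶠ-refl

  ≈ᶠ-trans : Transitive (_≈ᶠ_ {AP})
  ≈ᶠ-trans (atom p)  (atom q)  = atom (trans p q)
  ≈ᶠ-trans ⊤ᶠ        ⊤ᶠ        = ⊤ᶠ
  ≈ᶠ-trans ⊥ᶠ        ⊥ᶠ        = ⊥ᶠ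
  ≈ᶠ-trans (¬ᶠ p)    (¬ᶠ q)    = ¬ᶠ ≈ᶠ-trans p q
  ≈ᶠ-trans (p ∧ᶠ p′) (q ∧ᶠ q′) = ≈ᶠ-trans p q ∧ᶠ ≈ᶠ-trans p′ q′
  ≈ᶠ-trans (p ∨ᶠ p′) (q ∨ᶠ q′) = ≈ᶠ-trans p q ∨ᶠ ≈ᶠ-trans p′ q′
  ≈ᶠ-trans (□[_]_ {I} {J} i p) (□[_]_ {J = K} j q) =
    □[ ≈ᴵ-trans {I} {J} {K} i j ] ≈ᶠ-trans p q
  ≈ᶠ-trans (◇[_]_ {I} {J} i p) (◇[_]_ {J = K} j q) =
    ◇[ ≈ᴵ-trans {I} {J} {K} i j ] ≈ᶠ-trans p q

  -- An equivalence rather than an implication, as ¬ᶠ reverses the direction.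
  ⊨-cong : ∀ {φ χ : Formula AP} → φ ≈ᶠ χ → ∀ e n → (e at n ⊨ φ) ⇔ (e at n ⊨ χ)
  ⊨-cong (atom refl) e n = ⇔-id _
  ⊨-cong ⊤ᶠ          e n = ⇔-id _
  ⊨-cong ⊥ᶠ          e n = ⇔-id _
  ⊨-cong (¬ᶠ p)      e n = ¬-cong-⇔ (⊨-cong p e n)
  ⊨-cong (p ∧ᶠ q)    e n = ⊨-cong p e n ×-⇔ ⊨-cong q e n
  ⊨-cong (p ∨ᶠ q)    e n = ⊨-cong p e n ⊎-⇔ ⊨-cong q e n
  ⊨-cong (□[_]_ {I} {J} i p) e n = mk⇔
    -- The guard of a box is a premise, so it travels against the formula: membership in `J` is
    -- pulled back to `I` before `h` applies.
    (λ h m n≤m ∈J → to (⊨-cong p e m) (h m n≤m (∈ᴵ-respects (time m - time n) {J} {I} (≈ᴵ-sym {I} {J} i) ∈J)))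
    (λ h m n≤m ∈I → from (⊨-cong p e m) (h m n≤m (∈ᴵ-respects (time m - time n) {I} {J} i ∈I)))
    where
    open TimedStream e
    open Equivalence
  ⊨-cong (◇[_]_ {I} {J} i p) e n = mk⇔
    -- The same event `m` serves as witness on both sides, and the guard now travels with the
    -- formula.
    (λ (m , n≤m , ∈I , h) →
      m , n≤m , ∈ᴵ-respects (time m - time n) {I} {J} i ∈I , to (⊨-cong p e m) h)
    (λ (m , n≤m , ∈J , h) →
      m , n≤m , ∈ᴵ-respects (time m - time n) {J} {I} (≈ᴵ-sym {I} {J} i) ∈J , from (⊨-cong p e m) h)
    where
    open TimedStream e
    open Equivalence

theorem1 : {ℓ r : Level} (AP : Set) → Finite AP →
    (𝒜 : ParameterEnvelope ℓ) →
    (R : Rel (Spec AP 𝒜) r) → IsAdmissibleRevision R →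
    (q : ℕ) (ψ : Fin (suc q) → Spec AP 𝒜) →
    (∀ (j : Fin q) → R (ψ (inject₁ j)) (ψ (suc j))) →
    ∀ (i : Fin (suc q)) →
    (core₁ (ψ i) ≈ᶠ core₁ (ψ zero) × core₂ (ψ i) ≈ᶠ core₂ (ψ zero))
    × (∀ (e : TimedStream AP) (n : ℕ) → e at n ⊨ core₁ (ψ zero) → e at n ⊨ trig (ψ i))
    × (∀ (e : TimedStream AP) (m : ℕ) → e at m ⊨ resp (ψ i) → e at m ⊨ core₂ (ψ zero))
    × params (ψ i) ∈ Member 𝒜
theorem1 AP _ 𝒜 R admissible q ψ chain i =
    cores
  -- `cores` has `ψ i` on its left, so leaving `ψ zero` takes `from`, and returning to it in the
  -- response clause takes `to`.
  , (λ e n → inj₁ ∘ Equivalence.from (⊨-cong (proj₁ cores) e n))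
  , (λ e m → Equivalence.to (⊨-cong (proj₂ cores) e m) ∘ proj₁)
  -- Every specification carries its own proof of envelope membership.
  , params∈𝒜 (ψ i)
  where
  open IsAdmissibleRevision admissible using (sameCores)

  SameCores : Fin (suc q) → Set
  SameCores j = core₁ (ψ j) ≈ᶠ core₁ (ψ zero) × core₂ (ψ j) ≈ᶠ core₂ (ψ zero)

  step : ∀ j → SameCores (inject₁ j) → SameCores (suc j)
  -- `sameCores` equates the revised cores with their predecessors, which the induction hypothesis
  -- already links to `ψ zero`.
  step j (c₁ , c₂) with s₁ , s₂ ← sameCores (chain j) = ≈ᶠ-trans s₁ c₁ , ≈ᶠ-trans s₂ c₂

  cores : SameCores i
  cores = <-weakInduction SameCores (≈ᶠ-refl , ≈ᶠ-refl) step i
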